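{- Let $p \in (0,\frac{1}{2})$ be a constant. No (possibly randomized) sorting algorithm can achieve, on a random instance with $n$ elements, maximum dislocation $o(\log n)$ with high probability (i.e., with probability at least $1 - \frac{1}{n}$).
   Context: Setting: the elements are $S=\{1,\dots,n\}$ with the natural order. A random instance consists of an input permutation of $S$ chosen uniformly at random together with comparison outcomes: for each pair $i<j$ independently, the comparison reports the wrong order with probability exactly $p$ and the correct order otherwise; outcomes are persistent (repeated comparisons of the same pair return the same outcome). The algorithm accesses the elements only via these comparisons and outputs a permutation of $S$. For a sequence and element $x$, the dislocation of $x$ is the absolute difference between its position and its true rank; the maximum dislocation is the maximum over all elements. -}

module Defs where

open import Level using (Level; _⊔_; 0ℓ) renaming (suc to lsuc)
open import Algebra.Apartness.Bundles using (HeytingCommutativeRing; HeytingField)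
import Algebra.Apartness.Properties.HeytingCommutativeRing as HeytingProperties
import Algebra.Definitions.RawMonoid as RawMonoidDefinitions
import Algebra.Properties.Ring as RingProperties
open import Algebra.Bundles using (CommutativeRing)
open import Data.Bool using (Bool; true; false; not)
open import Data.Empty using (⊥-elim)
open import Data.Fin using (Fin; zero; suc; toℕ; punchIn)
open import Data.Fin.Permutation as Perm
  using (Permutation′; _⟨$⟩ʳ_; _⟨$⟩ˡ_; _∘ₚ_; insert; remove)
open import Data.Fin.Properties using (punchIn-injective)
open import Data.List using (List; []; _∷_; [_]; map; foldr; concatMap; filter; length; allFin; cartesianProductWith)
open import Data.List.Extrema.Nat using (max)
import Data.List.Membership.Setoid as SetoidMembership
open import Data.List.Membership.Setoid.Properties using (∈-cartesianProductWith⁺; ∈-resp-≈)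
open import Data.List.Membership.Propositional.Properties using (∈-allFin)
open import Data.List.Relation.Unary.All using (All; []; _∷_)
open import Data.List.Relation.Unary.Any using (Any; here; there)
open import Data.List.Relation.Unary.AllPairs using ([]; _∷_)
import Data.List.Relation.Unary.Unique.Setoid as SetoidUnique
import Data.List.Relation.Unary.Unique.Setoid.Properties as SetoidUniqueₚ
open import Data.List.Relation.Unary.Unique.Propositional.Properties using (allFin⁺)
open import Data.Nat using (ℕ; zero; suc; NonZero; nonZero; ∣_-_∣)
  renaming (_*_ to _*ℕ_; _≤_ to _≤ℕ_)
open import Data.Product using (_×_; _,_; proj₁; proj₂; ∃; map₁)
open import Data.Sum using (_⊎_; inj₁; inj₂)
open import Data.Unit using (⊤; tt)
open import Data.Vec using (Vec; []; _∷_; lookup)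
open import Function using (_∘_)
open import Relation.Binary using (Rel; Setoid; IsStrictPartialOrder)
open import Relation.Binary.PropositionalEquality as ≡ using (_≡_; cong)
open import Relation.Nullary using (¬_)
open import Relation.Unary using (Pred; Decidable)

-- The library has no real numbers.  The field of scalars is an arbitrary
-- Archimedean ordered field, axiomatised constructively so that the classical
-- reals, the Cauchy and Dedekind reals and the rationals are all instances.
record ArchimedeanOrderedField c ℓ₁ ℓ₂ ℓ₃ : Set (lsuc (c ⊔ ℓ₁ ⊔ ℓ₂ ⊔ ℓ₃)) where
  infix 4 _<_ _≤_
  infix 8 _×1
  field
    heytingField : HeytingField c ℓ₁ ℓ₂

  open HeytingField heytingField public hiding (zero)
  open HeytingCommutativeRing heytingCommutativeRing public using (commutativeRing)

  open RawMonoidDefinitions (CommutativeRing.+-rawMonoid commutativeRing) using () renaming (_×_ to _·_)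

  _×1 : ℕ → Carrier
  n ×1 = n · 1#

  field
    _<_                  : Rel Carrier ℓ₃
    isStrictPartialOrder : IsStrictPartialOrder _≈_ _<_
    #⇒<⊎>                : ∀ {x y} → x # y → (x < y) ⊎ (y < x)
    <⇒#                  : ∀ {x y} → x < y → x # y
    +-monoˡ-<            : ∀ {x y} z → x < y → x + z < y + z
    *-positive           : ∀ {x y} → 0# < x → 0# < y → 0# < x * y
    archimedean          : ∀ x → ∃ λ n → x < n ×1

  private module SPO = IsStrictPartialOrder isStrictPartialOrder
  private module R = RingProperties (CommutativeRing.ring commutativeRing)

  _≤_ : Rel Carrier ℓ₃
  x ≤ y = ¬ (y < x)

  0<1 : 0# < 1#
  0<1 with #⇒<⊎> (HeytingProperties.1#0 heytingCommutativeRing)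
  ... | inj₂ 0<1 = 0<1
  ... | inj₁ 1<0 = ⊥-elim (SPO.irrefl refl (SPO.trans 0<1′ 1<0))
    where
    0<-1 : 0# < - 1#
    0<-1 = SPO.<-respˡ-≈ (-‿inverseʳ 1#)
             (SPO.<-respʳ-≈ (+-identityˡ (- 1#)) (+-monoˡ-< (- 1#) 1<0))
    0<1′ : 0# < 1#
    0<1′ = SPO.<-respʳ-≈
      (trans (sym (R.-‿distribˡ-* 1# (- 1#)))
        (trans (-‿cong (*-identityˡ (- 1#))) (R.-‿involutive 1#)))
      (*-positive 0<-1 0<-1)

  0<n×1 : ∀ n .{{_ : NonZero n}} → 0# < n ×1
  0<n×1 (suc zero)    = SPO.<-respʳ-≈ (sym (+-identityʳ 1#)) 0<1
  0<n×1 (suc (suc n)) = SPO.trans (0<n×1 (suc n))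
    (SPO.<-respˡ-≈ (+-identityˡ _) (+-monoˡ-< (suc n ×1) 0<1))

  1/_ : ∀ n .{{_ : NonZero n}} → Carrier
  1/ n = proj₁ (#⇒invertible (#-sym (<⇒# (0<n×1 n))))

  n×1*1/n≈1 : ∀ n .{{_ : NonZero n}} → n ×1 * 1/ n ≈ 1#
  n×1*1/n≈1 n = trans
    (*-congʳ (sym (HeytingProperties.x-0≈x heytingCommutativeRing (n ×1))))
    (proj₂ (proj₂ (#⇒invertible (#-sym (<⇒# (0<n×1 n))))))

permutationSetoid : ℕ → Setoid 0ℓ 0ℓ
permutationSetoid n = record
  { Carrier       = Permutation′ n
  ; _≈_           = Perm._≈_
  ; isEquivalence = record
    { refl  = λ _ → ≡.refl
    ; sym   = λ e i → ≡.sym (e i)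
    ; trans = λ d e i → ≡.trans (d i) (e i)
    }
  }

permutations : ∀ n → List (Permutation′ n)
permutations zero    = [ Perm.id ]
permutations (suc n) = cartesianProductWith (insert zero) (allFin (suc n)) (permutations n)

private
  insert-cong : ∀ {n} {j k : Fin (suc n)} {π ρ : Permutation′ n} →
                j ≡ k → π Perm.≈ ρ → insert zero j π Perm.≈ insert zero k ρ
  insert-cong ≡.refl π≈ρ zero = ≡.refl
  insert-cong {j = j} {π = π} {ρ} ≡.refl π≈ρ (suc i) =
    ≡.trans (Perm.insert-punchIn zero j π i)
      (≡.trans (cong (punchIn j) (π≈ρ i)) (≡.sym (Perm.insert-punchIn zero j ρ i)))

  insert-injective : ∀ {n} {j k : Fin (suc n)} {π ρ : Permutation′ n} →
                     insert zero j π Perm.≈ insert zero k ρ → j ≡ k × π Perm.≈ ρ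
  insert-injective {j = j} {k} {π} {ρ} e with ≡.refl ← e zero = ≡.refl , λ i →
    punchIn-injective j _ _ (≡.trans (≡.sym (Perm.insert-punchIn zero j π i))
      (≡.trans (e (suc i)) (Perm.insert-punchIn zero j ρ i)))

permutations-complete : ∀ n π → SetoidMembership._∈_ (permutationSetoid n) π (permutations n)
permutations-complete zero    π = here λ ()
permutations-complete (suc n) π =
  ∈-resp-≈ (permutationSetoid (suc n)) {xs = permutations (suc n)}
    {insert zero (π ⟨$⟩ʳ zero) (remove zero π)} {π}
    (Perm.insert-remove zero π)
    (∈-cartesianProductWith⁺ (≡.setoid _) (permutationSetoid n) (permutationSetoid (suc n))
      insert-cong (∈-allFin (π ⟨$⟩ʳ zero)) (permutations-complete n (remove zero π)))

permutations-unique : ∀ n → SetoidUnique.Unique (permutationSetoid n) (permutations n)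
permutations-unique zero    = [] ∷ []
permutations-unique (suc n) =
  SetoidUniqueₚ.cartesianProductWith⁺ (≡.setoid _) (permutationSetoid n) (permutationSetoid (suc n))
    (insert zero) insert-injective (allFin⁺ (suc n)) (permutations-unique n)

permutations-nonEmpty : ∀ n → NonZero (length (permutations n))
permutations-nonEmpty n = nonEmpty (permutations-complete n Perm.id)
  where
  nonEmpty : ∀ {a p} {A : Set a} {P : Pred A p} {xs} → Any P xs → NonZero (length xs)
  nonEmpty (here _)  = nonZero
  nonEmpty (there _) = nonZero

-- One bit for each pair i < j of elements; `true` means that the comparison of
-- i and j is wrong.  The head vector holds the bits of the pairs (0 , 1), (0 , 2), …
Errors : ℕ → Set
Errors zero    = ⊤
Errors (suc n) = Vec Bool n × Errors n

-- Whether the comparison of elements x and y reports x as the smaller one.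
-- Comparing an element with itself carries no information.
reportsLess : ∀ {n} → Errors n → Fin n → Fin n → Bool
reportsLess (bs , e) zero    zero    = false
reportsLess (bs , e) zero    (suc y) = not (lookup bs y)
reportsLess (bs , e) (suc x) zero    = lookup bs x
reportsLess (bs , e) (suc x) (suc y) = reportsLess e x y

-- A sequence of all the elements is a permutation s with s ⟨$⟩ʳ r the element
-- at position r.  Positions and ranks both count from 0.
dislocation : ∀ {n} → Permutation′ n → Fin n → ℕ
dislocation s x = ∣ toℕ (s ⟨$⟩ˡ x) - toℕ x ∣

maxDislocation : ∀ {n} → Permutation′ n → ℕ
maxDislocation {n} s = max 0 (map (dislocation s) (allFin n))

-- f(n) = o(g(n)), with the arbitrarily small constant taken of the form 1/k.
-- As f is integer valued, k f(n) ≤ log₂ n iff k f(n) ≤ ⌊log₂ n⌋.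
_∈o_ : (ℕ → ℕ) → (ℕ → ℕ) → Set
f ∈o g = ∀ k → ∃ λ N → ∀ n → N ≤ℕ n → k *ℕ f n ≤ℕ g n

module Sorting {c ℓ₁ ℓ₂ ℓ₃} (F : ArchimedeanOrderedField c ℓ₁ ℓ₂ ℓ₃) where
  open ArchimedeanOrderedField F

  private variable
    a b : Level
    A : Set a
    B : Set b
    n : ℕ

  -- Finitely supported distributions as lists of weighted outcomes; an outcome
  -- may be listed more than once.
  Dist : Set a → Set (a ⊔ c)
  Dist A = List (Carrier × A)

  total : List Carrier → Carrier
  total = foldr _+_ 0#

  IsProbability : Dist A → Set (c ⊔ ℓ₁ ⊔ ℓ₃)
  IsProbability d = All (0# ≤_) (map proj₁ d) × total (map proj₁ d) ≈ 1#

  Pr : ∀ {p} {P : Pred A p} → Dist A → Decidable P → Carrier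
  Pr d P? = total (map proj₁ (filter (P? ∘ proj₂) d))

  return : A → Dist A
  return x = [ 1# , x ]

  infixl 1 _>>=_
  _>>=_ : Dist A → (A → Dist B) → Dist B
  d >>= k = concatMap (λ (w , x) → map (map₁ (w *_)) (k x)) d

  uniform : (xs : List A) .{{_ : NonZero (length xs)}} → Dist A
  uniform xs = map (1/ length xs ,_) xs

  bernoulli : Carrier → Dist Bool
  bernoulli p = (p , true) ∷ (1# - p , false) ∷ []

  replicate : ∀ m → Dist A → Dist (Vec A m)
  replicate zero    d = return []
  replicate (suc m) d = do
    x  ← d
    xs ← replicate m d
    return (x ∷ xs)

  randomPermutation : ∀ n → Dist (Permutation′ n)
  randomPermutation n = uniform (permutations n) {{permutations-nonEmpty n}}

  randomErrors : Carrier → ∀ n → Dist (Errors n)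
  randomErrors p zero    = return tt
  randomErrors p (suc n) = do
    bs ← replicate n (bernoulli p)
    e  ← randomErrors p n
    return (bs , e)

  -- The input permutation maps each input position to the element found there.
  randomInstance : Carrier → ∀ n → Dist (Permutation′ n × Errors n)
  randomInstance p n = do
    π ← randomPermutation n
    e ← randomErrors p n
    return (π , e)

  -- An algorithm sees elements only through their input positions.  It may
  -- adaptively compare any two, draw from any finite distribution, and finally
  -- return a sequence σ, with σ ⟨$⟩ʳ r the input position of the element that
  -- is placed at output position r.
  data Algorithm (n : ℕ) : Set (c ⊔ ℓ₁ ⊔ ℓ₃) where
    output  : Permutation′ n → Algorithm n
    compare : (i j : Fin n) → (Bool → Algorithm n) → Algorithm n
    draw    : ∀ {m} (d : Dist (Fin m)) → IsProbability d → (Fin m → Algorithm n) → Algorithm n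

  run : Algorithm n → (Fin n → Fin n → Bool) → Dist (Permutation′ n)
  run (output σ)      less = return σ
  run (compare i j k) less = run (k (less i j)) less
  run (draw d _ k)    less = d >>= λ x → run (k x) less

  randomOutput : Carrier → Algorithm n → Dist (Permutation′ n)
  randomOutput {n} p alg = do
    (π , e) ← randomInstance p n
    σ       ← run alg (λ i j → reportsLess e (π ⟨$⟩ʳ i) (π ⟨$⟩ʳ j))
    return (σ ∘ₚ π)

module RationalModel where
  open import Data.Integer as ℤ using (+_; -[1+_])
  import Data.Integer.Properties as ℤₚ
  import Data.Nat.Properties as ℕₚ
  open import Data.Rational.Unnormalised as ℚ using (ℚᵘ; mkℚᵘ; 1ℚᵘ; _≃_; _≄_; *≡*; *<*)
  import Data.Rational.Unnormalised.Properties as ℚₚ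
  open import Relation.Binary.Definitions using (tri<; tri≈; tri>)

  open RawMonoidDefinitions ℚ.+-0-rawMonoid using () renaming (_×_ to _·_)

  private
    n·1≃n : ∀ n → n · 1ℚᵘ ≃ mkℚᵘ (+ n) 0
    n·1≃n zero    = ℚₚ.≃-refl
    n·1≃n (suc n) = ℚₚ.≃-trans (ℚₚ.+-cong {1ℚᵘ} ℚₚ.≃-refl (n·1≃n n))
      (*≡* (cong (λ z → (+ 1 ℤ.+ z) ℤ.* + 1) (ℤₚ.*-identityʳ (+ n))))

    archimedean : ∀ x → ∃ λ n → x ℚ.< n · 1ℚᵘ
    archimedean (mkℚᵘ -[1+ m ] d) = 0 , *<* ℤ.-<+
    archimedean x@(mkℚᵘ (+ m) d)  = suc m , ℚₚ.<-respʳ-≃ {x} (ℚₚ.≃-sym (n·1≃n (suc m)))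
      (*<* (≡.subst₂ ℤ._<_ (≡.sym (ℤₚ.*-identityʳ (+ m))) (ℤₚ.pos-* (suc m) (suc d))
        (ℤ.+<+ (ℕₚ.m≤m*n (suc m) (suc d)))))

    ≄⇒<⊎> : ∀ {x y} → x ≄ y → x ℚ.< y ⊎ y ℚ.< x
    ≄⇒<⊎> {x} {y} x≄y with ℚₚ.<-cmp x y
    ... | tri< x<y _   _   = inj₁ x<y
    ... | tri≈ _   x≃y _   = ⊥-elim (x≄y x≃y)
    ... | tri> _   _   y<x = inj₂ y<x

  rationals : ArchimedeanOrderedField 0ℓ 0ℓ 0ℓ 0ℓ
  rationals = record
    { heytingField         = ℚₚ.+-*-heytingField
    ; _<_                  = ℚ._<_
    ; isStrictPartialOrder = ℚₚ.<-isStrictPartialOrder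
    ; #⇒<⊎>                = ≄⇒<⊎>
    ; <⇒#                  = λ x<y x≃y → ℚₚ.<-irrefl x≃y x<y
    ; +-monoˡ-<            = λ z x<y → ℚₚ.+-monoˡ-< z x<y
    ; *-positive           = λ {x} {y} 0<x 0<y → ℚₚ.positive⁻¹ (x ℚ.* y)
        ⦃ ℚₚ.pos*pos⇒pos x ⦃ ℚ.positive 0<x ⦄ y ⦃ ℚ.positive 0<y ⦄ ⦄
    ; archimedean          = archimedean
    }

{-# OPTIONS --safe #-}
module Submission where

-- Let d > 2m and let ρ be the cyclic shift that sends element 0 to d and moves
-- 1, …, d down by one.  Replace the input permutation π by ρ ∘ π and flip d error
-- bits so that all comparisons report the same answers.  The algorithm then
-- behaves identically, so if the dislocation of 0 was at most m before, that of
-- d exceeds m now.  Flipping a bit costs a factor p at most, whence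
-- p^d Pr(good) ≤ Pr(bad) = 1 - Pr(good).  With Pr(good) ≥ 1 - 1/n this gives
-- p^d (n - 1) ≤ 1, which fails for large n if d = 2m + 1 and m = o(log n).

open import Defs
open import Level using (Level)
open import Algebra.Bundles using (CommutativeRing)
import Algebra.Apartness.Properties.HeytingCommutativeRing as HeytingProperties
import Algebra.Properties.CommutativeSemigroup as CommutativeSemigroupProperties
import Algebra.Properties.Ring as RingProperties
import Algebra.Properties.Semiring.Exp as SemiringExponentiation
import Algebra.Properties.Semiring.Mult as SemiringMultiplication
open import Data.Bool using (Bool; true; false; not; if_then_else_)
open import Data.Bool.Properties using (not-involutive)
open import Data.Empty using (⊥-elim)
open import Data.Fin using (Fin; zero; suc; toℕ; fromℕ<; punchIn)
open import Data.Fin.Permutation as Perm using (Permutation′; _⟨$⟩ʳ_; _⟨$⟩ˡ_; _∘ₚ_; inverseˡ; inverseʳ)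
open import Data.Fin.Properties using (toℕ-fromℕ<)
open import Data.List using (List; []; _∷_; _++_; map; length; allFin)
open import Data.List.Extrema.Nat using (max; xs≤max)
open import Data.List.Membership.Propositional.Properties using (∈-allFin; ∈-map⁺)
import Data.List.Membership.Setoid as SetoidMembership
open import Data.List.Properties using (concatMap-cong; map-cong)
open import Data.List.Relation.Unary.All as All using (All; []; _∷_)
import Data.List.Relation.Unary.All.Properties as Allₚ
open import Data.List.Relation.Unary.AllPairs using ([]; _∷_)
open import Data.List.Relation.Unary.Any using (here; there; _─_)
import Data.List.Relation.Unary.Unique.Setoid as SetoidUnique
import Data.List.Relation.Unary.Unique.Setoid.Properties as SetoidUniqueₚ
open import Data.Nat as ℕ using (ℕ; zero; suc; NonZero; _≤?_; s≤s; z≤n)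
  renaming (_≤_ to _≤ℕ_; _<_ to _<ℕ_; _+_ to _+ℕ_; _*_ to _*ℕ_; _^_ to _^ℕ_)
open import Data.Nat.Logarithm using (⌊log₂_⌋; ⌊log₂[2^n]⌋≡n)
import Data.Nat.Properties as ℕₚ
open import Data.Nat.Solver using (module +-*-Solver)
open import Data.Product using (_×_; _,_; proj₁; proj₂; ∃; map₁)
open import Data.Sum using (_⊎_; inj₁; inj₂)
open import Data.Unit using (tt)
open import Data.Vec using (Vec; []; _∷_; lookup; insertAt)
open import Data.Vec.Properties using (insertAt-lookup; insertAt-punchIn)
open import Function using (_∘_; const)
open import Relation.Binary using (Setoid; IsStrictPartialOrder; Preorder)
import Relation.Binary.Reasoning.Preorder as PreorderReasoning
import Relation.Binary.Reasoning.Setoid as SetoidReasoning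
open import Relation.Binary.PropositionalEquality as ≡ using (_≡_; cong; cong₂)
open import Relation.Nullary using (¬_; yes; no; does)
open import Relation.Nullary.Decidable using (¬?)
open import Relation.Unary using (Pred; Decidable)

private variable
  n : ℕ

-- Cyclic shifts of the elements: comparisons and dislocation.

cycle : Fin (suc n) → Permutation′ (suc n)
cycle d = Perm.insert zero d Perm.id

-- The errors for which the elements, renamed by `cycle d`, compare as before.
cycleErrors : Fin (suc n) → Errors (suc n) → Errors (suc n)
cycleErrors             zero    e                   = e
cycleErrors {n = suc _} (suc d) (b ∷ bs , cs , e) = insertAt cs d (not b) , cycleErrors d (bs , e)

private
  -- A form of `cycle d` that reduces on `zero` and `suc`; `insert` satisfies the second equation
  -- only propositionally.
  cycle′ : Fin (suc n) → Fin (suc n) → Fin (suc n)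
  cycle′ d zero    = d
  cycle′ d (suc i) = punchIn d i

  cycle≗cycle′ : (d : Fin (suc n)) → ∀ i → cycle d ⟨$⟩ʳ i ≡ cycle′ d i
  cycle≗cycle′ d zero    = ≡.refl
  cycle≗cycle′ d (suc i) = Perm.insert-punchIn zero d Perm.id i

  -- Induction on the shift distance. Under a shift by `suc d`, element 1 becomes the new minimum,
  -- so its row `cs` comes first. Its bit against the old minimum is inserted at `d`, negated
  -- because the two have changed their order. With element 1 removed, the others undergo a shift by
  -- `d` with errors `(bs , e)`.
  reportsLess-cycle′ : ∀ (d : Fin (suc n)) e x y →
    reportsLess (cycleErrors d e) (cycle′ d x) (cycle′ d y) ≡ reportsLess e x y
  reportsLess-cycle′ zero e zero    zero    = ≡.refl
  reportsLess-cycle′ zero e zero    (suc y) = ≡.refl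
  reportsLess-cycle′ zero e (suc x) zero    = ≡.refl
  reportsLess-cycle′ zero e (suc x) (suc y) = ≡.refl
  reportsLess-cycle′ {suc n} (suc d) (b ∷ bs , cs , e) zero zero =
    reportsLess-cycle′ d (bs , e) zero zero
  reportsLess-cycle′ {suc n} (suc d) (b ∷ bs , cs , e) zero (suc zero) =
    insertAt-lookup cs d (not b)
  reportsLess-cycle′ {suc n} (suc d) (b ∷ bs , cs , e) zero (suc (suc y)) =
    reportsLess-cycle′ d (bs , e) zero (suc y)
  reportsLess-cycle′ {suc n} (suc d) (b ∷ bs , cs , e) (suc zero) zero =
    ≡.trans (cong not (insertAt-lookup cs d (not b))) (not-involutive b)
  reportsLess-cycle′ {suc n} (suc d) (b ∷ bs , cs , e) (suc zero) (suc zero) = ≡.refl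
  reportsLess-cycle′ {suc n} (suc d) (b ∷ bs , cs , e) (suc zero) (suc (suc y)) =
    cong not (insertAt-punchIn cs d (not b) y)
  reportsLess-cycle′ {suc n} (suc d) (b ∷ bs , cs , e) (suc (suc x)) zero =
    reportsLess-cycle′ d (bs , e) (suc x) zero
  reportsLess-cycle′ {suc n} (suc d) (b ∷ bs , cs , e) (suc (suc x)) (suc zero) =
    insertAt-punchIn cs d (not b) x
  reportsLess-cycle′ {suc n} (suc d) (b ∷ bs , cs , e) (suc (suc x)) (suc (suc y)) =
    reportsLess-cycle′ d (bs , e) (suc x) (suc y)

reportsLess-cycle : ∀ (d : Fin (suc n)) e x y →
  reportsLess (cycleErrors d e) (cycle d ⟨$⟩ʳ x) (cycle d ⟨$⟩ʳ y) ≡ reportsLess e x y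
reportsLess-cycle d e x y =
  ≡.trans (cong₂ (reportsLess (cycleErrors d e)) (cycle≗cycle′ d x) (cycle≗cycle′ d y))
    (reportsLess-cycle′ d e x y)

⟨$⟩ˡ-cong : {s t : Permutation′ n} → s Perm.≈ t → ∀ x → s ⟨$⟩ˡ x ≡ t ⟨$⟩ˡ x
⟨$⟩ˡ-cong {s = s} {t} s≈t x = ≡.trans
  (cong (s ⟨$⟩ˡ_) (≡.sym (≡.trans (s≈t (t ⟨$⟩ˡ x)) (inverseʳ t)))) (inverseˡ s)

maxDislocation-cong : {s t : Permutation′ n} → s Perm.≈ t → maxDislocation s ≡ maxDislocation t
maxDislocation-cong {n} {s} {t} s≈t = cong (max 0)
  (map-cong (λ x → cong (λ i → ℕ.∣ toℕ i - toℕ x ∣) (⟨$⟩ˡ-cong {s = s} {t} s≈t x)) (allFin n))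

dislocation≤maxDislocation : (s : Permutation′ n) → ∀ x → dislocation s x ≤ℕ maxDislocation s
dislocation≤maxDislocation {n} s x =
  All.lookup (xs≤max 0 (map (dislocation s) (allFin n))) (∈-map⁺ (dislocation s) (∈-allFin x))

-- Element 0 in s and element d in s ∘ₚ cycle d have the same position, and no
-- position is within m of both ranks.
cycle-dislocates : ∀ {m} (d : Fin (suc n)) → m +ℕ m <ℕ toℕ d → (s : Permutation′ (suc n)) →
                   maxDislocation s ≤ℕ m → ¬ maxDislocation (s ∘ₚ cycle d) ≤ℕ m
cycle-dislocates {m = m} d 2m<d s s≤m sc≤m = ℕₚ.<⇒≱ 2m<d (begin
  toℕ d                              ≤⟨ ℕₚ.m≤n+∣n-m∣ (toℕ d) r ⟩
  r +ℕ ℕ.∣ r - toℕ d ∣               ≤⟨ ℕₚ.+-mono-≤ r≤m ∣r-d∣≤m ⟩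
  m +ℕ m                             ∎)
  where
  open ℕₚ.≤-Reasoning
  r = toℕ (s ⟨$⟩ˡ zero)
  r≤m : r ≤ℕ m
  r≤m = ≡.subst (_≤ℕ m) (ℕₚ.∣-∣-identityʳ r)
    (ℕₚ.≤-trans (dislocation≤maxDislocation s zero) s≤m)
  ∣r-d∣≤m : ℕ.∣ r - toℕ d ∣ ≤ℕ m
  ∣r-d∣≤m = ≡.subst (λ i → ℕ.∣ toℕ (s ⟨$⟩ˡ i) - toℕ d ∣ ≤ℕ m) (inverseˡ (cycle d) {zero})
    (ℕₚ.≤-trans (dislocation≤maxDislocation (s ∘ₚ cycle d) d) sc≤m)


-- Constructive order arithmetic in the field of scalars.

module OrderedFieldProperties {c ℓ₁ ℓ₂ ℓ₃} (F : ArchimedeanOrderedField c ℓ₁ ℓ₂ ℓ₃) where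
  open ArchimedeanOrderedField F
  open IsStrictPartialOrder isStrictPartialOrder public
    using (<-respˡ-≈; <-respʳ-≈) renaming (irrefl to <-irrefl; trans to <-trans)
  private module R = CommutativeRing commutativeRing
  open RingProperties R.ring using (-‿distribʳ-*)
  open SemiringExponentiation R.semiring public using (_^_)
  open SemiringMultiplication R.semiring using (×1-homo-*)
  open CommutativeSemigroupProperties R.*-commutativeSemigroup using () renaming (interchange to *-interchange)
  open HeytingProperties heytingCommutativeRing using (invertibleʳ⇒#; x-0≈x; #-congʳ)

  private variable
    x y z w : Carrier

  -- Takes the place of trichotomy, which the axioms do not give. Cotransitivity of `#` separates
  -- `z` from `x` or from `y`; if the order on that pair is the unwanted one, transitivity with
  -- `x < y` yields the other alternative.
  <-cotrans : x < y → ∀ z → x < z ⊎ z < y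
  <-cotrans x<y z with #-cotrans (<⇒# x<y) z
  ... | inj₁ x#z with #⇒<⊎> x#z
  ...   | inj₁ x<z = inj₁ x<z
  ...   | inj₂ z<x = inj₂ (<-trans z<x x<y)
  <-cotrans x<y z | inj₂ z#y with #⇒<⊎> z#y
  ...   | inj₁ z<y = inj₂ z<y
  ...   | inj₂ y<z = inj₁ (<-trans x<y y<z)

  ≤-reflexive : x ≈ y → x ≤ y
  ≤-reflexive x≈y = <-irrefl (sym x≈y)

  ≤-trans : x ≤ y → y ≤ z → x ≤ z
  ≤-trans {y = y} x≤y y≤z z<x with <-cotrans z<x y
  ... | inj₁ z<y = y≤z z<y
  ... | inj₂ y<x = x≤y y<x

  <-≤-trans : x < y → y ≤ z → x < z
  <-≤-trans {z = z} x<y y≤z with <-cotrans x<y z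
  ... | inj₁ x<z = x<z
  ... | inj₂ z<y = ⊥-elim (y≤z z<y)

  ≤-refl : x ≤ x
  ≤-refl = ≤-reflexive refl

  <⇒≤ : x < y → x ≤ y
  <⇒≤ x<y y<x = <-irrefl refl (<-trans x<y y<x)

  ≤-preorder : Preorder c ℓ₁ ℓ₃
  ≤-preorder = record
    { _≲_        = _≤_
    ; isPreorder = record
      { isEquivalence = isEquivalence
      ; reflexive     = ≤-reflexive
      ; trans         = ≤-trans
      }
    }

  module ≤-Reasoning = PreorderReasoning ≤-preorder

  x+z-z≈x : ∀ x z → (x + z) - z ≈ x
  x+z-z≈x x z = trans (+-assoc x z (- z)) (trans (+-congˡ (-‿inverseʳ z)) (+-identityʳ x))

  x-z+z≈x : ∀ x z → (x - z) + z ≈ x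
  x-z+z≈x x z = trans (+-assoc x (- z) z) (trans (+-congˡ (-‿inverseˡ z)) (+-identityʳ x))

  +-cancelʳ-< : x + z < y + z → x < y
  +-cancelʳ-< {x} {z} {y} lt =
    <-respˡ-≈ (x+z-z≈x x z) (<-respʳ-≈ (x+z-z≈x y z) (+-monoˡ-< (- z) lt))

  +-monoˡ-≤ : ∀ z → x ≤ y → x + z ≤ y + z
  +-monoˡ-≤ z x≤y lt = x≤y (+-cancelʳ-< lt)

  +-cancelʳ-≤ : ∀ z → x + z ≤ y + z → x ≤ y
  +-cancelʳ-≤ z le lt = le (+-monoˡ-< z lt)

  +-mono-≤ : x ≤ y → z ≤ w → x + z ≤ y + w
  +-mono-≤ {x} {y} {z} {w} x≤y z≤w = begin
    x + z  ≲⟨ +-monoˡ-≤ z x≤y ⟩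
    y + z  ≈⟨ +-comm y z ⟩
    z + y  ≲⟨ +-monoˡ-≤ y z≤w ⟩
    w + y  ≈⟨ +-comm w y ⟩
    y + w  ∎
    where open ≤-Reasoning

  x≤y⇒0≤y-x : x ≤ y → 0# ≤ y - x
  x≤y⇒0≤y-x {x} {y} x≤y = +-cancelʳ-≤ x (begin
    0# + x       ≈⟨ +-identityˡ x ⟩
    x            ≲⟨ x≤y ⟩
    y            ≈⟨ x-z+z≈x y x ⟨
    (y - x) + x  ∎)
    where open ≤-Reasoning

  0≤y-x⇒x≤y : 0# ≤ y - x → x ≤ y
  0≤y-x⇒x≤y {y} {x} le = begin
    x            ≈⟨ +-identityˡ x ⟨
    0# + x       ≲⟨ +-monoˡ-≤ x le ⟩
    (y - x) + x  ≈⟨ x-z+z≈x y x ⟩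
    y            ∎
    where open ≤-Reasoning

  x*y#0⇒x#0 : x * y # 0# → x # 0#
  x*y#0⇒x#0 {x} {y} xy#0 = let (i , _ , xyi≈1) = #⇒invertible xy#0 in
    invertibleʳ⇒# (y * i , trans (*-congʳ (x-0≈x x))
      (trans (sym (*-assoc x y i)) (trans (*-congʳ (sym (x-0≈x (x * y)))) xyi≈1)))

  0≤x∧x#0⇒0<x : 0# ≤ x → x # 0# → 0# < x
  0≤x∧x#0⇒0<x 0≤x x#0 with #⇒<⊎> x#0
  ... | inj₁ x<0 = ⊥-elim (0≤x x<0)
  ... | inj₂ 0<x = 0<x

  -- Whether a nonnegative number is zero or positive is undecidable in general. A negative product,
  -- however, is apart from zero and hence invertible; then both factors are invertible, hence
  -- positive, which contradicts the sign of the product.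
  *-nonNegative : 0# ≤ x → 0# ≤ y → 0# ≤ x * y
  *-nonNegative {x} {y} 0≤x 0≤y xy<0 = <⇒≤ (*-positive 0<x 0<y) xy<0
    where
    0<x = 0≤x∧x#0⇒0<x 0≤x (x*y#0⇒x#0 (<⇒# xy<0))
    0<y = 0≤x∧x#0⇒0<x 0≤y (x*y#0⇒x#0 (#-congʳ (*-comm x y) (<⇒# xy<0)))

  *-monoʳ-≤ : 0# ≤ z → x ≤ y → z * x ≤ z * y
  *-monoʳ-≤ {z} {x} {y} 0≤z x≤y = 0≤y-x⇒x≤y (begin
    0#             ≲⟨ *-nonNegative 0≤z (x≤y⇒0≤y-x x≤y) ⟩
    z * (y - x)    ≈⟨ distribˡ z y (- x) ⟩
    z * y + z * - x ≈⟨ +-congˡ (-‿distribʳ-* z x) ⟨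
    z * y - z * x  ∎)
    where open ≤-Reasoning

  *-monoˡ-≤ : 0# ≤ z → x ≤ y → x * z ≤ y * z
  *-monoˡ-≤ {z} {x} {y} 0≤z x≤y = begin
    x * z  ≈⟨ *-comm x z ⟩
    z * x  ≲⟨ *-monoʳ-≤ 0≤z x≤y ⟩
    z * y  ≈⟨ *-comm z y ⟩
    y * z  ∎
    where open ≤-Reasoning

  0≤1 : 0# ≤ 1#
  0≤1 = <⇒≤ 0<1

  0≤n×1 : ∀ n → 0# ≤ n ×1
  0≤n×1 zero    = ≤-refl
  0≤n×1 (suc n) = <⇒≤ (0<n×1 (suc n))

  0≤1/n : ∀ n .{{_ : NonZero n}} → 0# ≤ 1/ n
  0≤1/n n 1/n<0 = ≤-trans (≤-reflexive (sym (n×1*1/n≈1 n)))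
    (≤-trans (*-monoʳ-≤ (0≤n×1 n) (<⇒≤ 1/n<0)) (≤-reflexive (zeroʳ (n ×1)))) 0<1

  ×1-mono-≤ : ∀ {m n} → m ≤ℕ n → m ×1 ≤ n ×1
  ×1-mono-≤ {n = n} z≤n = 0≤n×1 n
  ×1-mono-≤ (s≤s m≤n)   = +-mono-≤ ≤-refl (×1-mono-≤ m≤n)

  ^-nonNegative : 0# ≤ x → ∀ n → 0# ≤ x ^ n
  ^-nonNegative 0≤x zero    = 0≤1
  ^-nonNegative 0≤x (suc n) = *-nonNegative 0≤x (^-nonNegative 0≤x n)

  x^d*m^d≈[x*m]^d : ∀ x m d → x ^ d * (m ^ℕ d) ×1 ≈ (x * m ×1) ^ d
  x^d*m^d≈[x*m]^d x m zero    = trans (*-identityˡ _) (+-identityʳ 1#)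
  x^d*m^d≈[x*m]^d x m (suc d) = trans (*-congˡ (×1-homo-* m (m ^ℕ d)))
    (trans (*-interchange x (x ^ d) (m ×1) ((m ^ℕ d) ×1)) (*-congˡ (x^d*m^d≈[x*m]^d x m d)))

  1<x⇒1≤x^n : 1# < x → ∀ n → 1# ≤ x ^ n
  1<x⇒1≤x^n 1<x zero    = ≤-refl
  1<x⇒1≤x^n 1<x (suc n) = ≤-trans (≤-trans (<⇒≤ 1<x) (≤-reflexive (sym (*-identityʳ _))))
    (*-monoʳ-≤ (<⇒≤ (<-trans 0<1 1<x)) (1<x⇒1≤x^n 1<x n))

  1<x⇒1<x^[1+n] : 1# < x → ∀ n → 1# < x ^ suc n
  1<x⇒1<x^[1+n] 1<x n = <-≤-trans (<-respʳ-≈ (sym (*-identityʳ _)) 1<x)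
    (*-monoʳ-≤ (<⇒≤ (<-trans 0<1 1<x)) (1<x⇒1≤x^n 1<x n))

  -- Any natural number above the inverse of `x` will do. For `x = p` it gives a base `m` whose
  -- powers outgrow the decay of the powers of `p`.
  archimedean-* : 0# < x → ∃ λ m → 1# < x * m ×1
  archimedean-* {x} 0<x = m , 1<xm
    where
    inverse = #⇒invertible (#-sym (<⇒# 0<x))
    i = proj₁ inverse
    m = proj₁ (archimedean i)
    xi≈1 : x * i ≈ 1#
    xi≈1 = trans (*-congʳ (sym (x-0≈x x))) (proj₂ (proj₂ inverse))
    0<m-i : 0# < m ×1 - i
    0<m-i = <-respˡ-≈ (-‿inverseʳ i) (+-monoˡ-< (- i) (proj₂ (archimedean i)))
    1<xm : 1# < x * m ×1
    1<xm = <-respˡ-≈ (trans (+-identityˡ _) xi≈1)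
      (<-respʳ-≈ (trans (sym (distribˡ x _ i)) (*-congˡ (x-z+z≈x (m ×1) i)))
        (+-monoˡ-< (x * i) (*-positive 0<x 0<m-i)))

  -- The form in which the hypothesis `p < 1/ 2` enters the probability estimates.
  x<1/2⇒x≤1-x : x < 1/ 2 → x ≤ 1# - x
  x<1/2⇒x≤1-x {x} x<½ = +-cancelʳ-≤ x (begin
    x + x            ≲⟨ +-mono-≤ (<⇒≤ x<½) (<⇒≤ x<½) ⟩
    1/ 2 + 1/ 2      ≈⟨ +-cong (sym (*-identityˡ _)) (sym (trans (*-congʳ (+-identityʳ 1#)) (*-identityˡ _))) ⟩
    1# * 1/ 2 + 1 ×1 * 1/ 2 ≈⟨ distribʳ (1/ 2) 1# (1 ×1) ⟨
    2 ×1 * 1/ 2      ≈⟨ n×1*1/n≈1 2 ⟩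
    1#               ≈⟨ x-z+z≈x 1# x ⟨
    (1# - x) + x     ∎)
    where open ≤-Reasoning

-- Expectations over finitely supported distributions.

module Expectation {c ℓ₁ ℓ₂ ℓ₃} (F : ArchimedeanOrderedField c ℓ₁ ℓ₂ ℓ₃) where
  open ArchimedeanOrderedField F
  open Sorting F
  open OrderedFieldProperties F
  private module R = CommutativeRing commutativeRing
  open CommutativeSemigroupProperties R.+-commutativeSemigroup using () renaming (interchange to +-interchange)
  open CommutativeSemigroupProperties R.*-commutativeSemigroup using () renaming (x∙yz≈y∙xz to x*yz≈y*xz)

  private variable
    a b q : Level
    A : Set a
    B : Set b
    C : Set q
    v w : Carrier

  𝔼 : Dist A → (A → Carrier) → Carrier
  𝔼 []            g = 0#
  𝔼 ((w , x) ∷ d) g = w * g x + 𝔼 d g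

  NonNegative : Dist A → Set _
  NonNegative d = All (0# ≤_) (map proj₁ d)

  𝔼-cong : ∀ (d : Dist A) {g h} → (∀ x → g x ≈ h x) → 𝔼 d g ≈ 𝔼 d h
  𝔼-cong []            g≈h = refl
  𝔼-cong ((w , x) ∷ d) g≈h = +-cong (*-congˡ (g≈h x)) (𝔼-cong d g≈h)

  𝔼-mono : ∀ {d : Dist A} {g h} → NonNegative d → (∀ x → g x ≤ h x) → 𝔼 d g ≤ 𝔼 d h
  𝔼-mono {d = []}          []           g≤h = ≤-refl
  𝔼-mono {d = (w , x) ∷ d} (0≤w ∷ 0≤d) g≤h = +-mono-≤ (*-monoʳ-≤ 0≤w (g≤h x)) (𝔼-mono 0≤d g≤h)

  𝔼-0 : ∀ (d : Dist A) → 𝔼 d (const 0#) ≈ 0#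
  𝔼-0 []            = refl
  𝔼-0 ((w , x) ∷ d) = trans (+-cong (zeroʳ w) (𝔼-0 d)) (+-identityˡ 0#)

  𝔼-+ : ∀ (d : Dist A) g h → 𝔼 d (λ x → g x + h x) ≈ 𝔼 d g + 𝔼 d h
  𝔼-+ []            g h = sym (+-identityˡ 0#)
  𝔼-+ ((w , x) ∷ d) g h = trans (+-cong (distribˡ w (g x) (h x)) (𝔼-+ d g h)) (+-interchange _ _ _ _)

  𝔼-*ˡ : ∀ (d : Dist A) v g → 𝔼 d (λ x → v * g x) ≈ v * 𝔼 d g
  𝔼-*ˡ []            v g = sym (zeroʳ v)
  𝔼-*ˡ ((w , x) ∷ d) v g = trans (+-cong (x*yz≈y*xz w v (g x)) (𝔼-*ˡ d v g)) (sym (distribˡ v _ _))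

  -- Fubini for finite sums; it serves to reorder independent random bits.
  𝔼-swap : ∀ (d : Dist A) (d′ : Dist B) (g : A → B → Carrier) →
           𝔼 d (λ x → 𝔼 d′ (g x)) ≈ 𝔼 d′ (λ y → 𝔼 d (λ x → g x y))
  𝔼-swap []            d′ g = sym (𝔼-0 d′)
  𝔼-swap ((w , x) ∷ d) d′ g =
    trans (+-cong (sym (𝔼-*ˡ d′ w (g x))) (𝔼-swap d d′ g)) (sym (𝔼-+ d′ _ _))

  𝔼-nonNegative : ∀ {d : Dist A} {g} → NonNegative d → (∀ x → 0# ≤ g x) → 0# ≤ 𝔼 d g
  𝔼-nonNegative {d = d} 0≤d 0≤g = ≤-trans (≤-reflexive (sym (𝔼-0 d))) (𝔼-mono 0≤d 0≤g)

  𝔼-++ : ∀ (d d′ : Dist A) g → 𝔼 (d ++ d′) g ≈ 𝔼 d g + 𝔼 d′ g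
  𝔼-++ []            d′ g = sym (+-identityˡ _)
  𝔼-++ ((w , x) ∷ d) d′ g = trans (+-congˡ (𝔼-++ d d′ g)) (sym (+-assoc _ _ _))

  𝔼-scale : ∀ w (d : Dist A) g → 𝔼 (map (map₁ (w *_)) d) g ≈ w * 𝔼 d g
  𝔼-scale w []            g = sym (zeroʳ w)
  𝔼-scale w ((v , x) ∷ d) g = trans (+-cong (*-assoc w v (g x)) (𝔼-scale w d g)) (sym (distribˡ w _ _))

  𝔼-return : ∀ (x : A) g → 𝔼 (return x) g ≈ g x
  𝔼-return x g = trans (+-identityʳ _) (*-identityˡ (g x))

  𝔼->>= : ∀ (d : Dist A) (k : A → Dist B) g → 𝔼 (d >>= k) g ≈ 𝔼 d (λ x → 𝔼 (k x) g)
  𝔼->>= []            k g = refl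
  𝔼->>= ((w , x) ∷ d) k g = trans (𝔼-++ (map (map₁ (w *_)) (k x)) _ g)
    (+-cong (𝔼-scale w (k x) g) (𝔼->>= d k g))

  𝔼-map : ∀ (d : Dist A) (f : A → B) g → 𝔼 (d >>= λ x → return (f x)) g ≈ 𝔼 d (g ∘ f)
  𝔼-map d f g = trans (𝔼->>= d (return ∘ f) g) (𝔼-cong d λ x → 𝔼-return (f x) g)

  𝔼-map₂ : ∀ (d : Dist A) (k : A → Dist B) (f : A → B → C) g →
           𝔼 (d >>= λ x → k x >>= λ y → return (f x y)) g ≈ 𝔼 d (λ x → 𝔼 (k x) (g ∘ f x))
  𝔼-map₂ d k f g = trans (𝔼->>= d _ g) (𝔼-cong d λ x → 𝔼-map (k x) (f x) g)

  indicator : {P : Pred A q} → Decidable P → A → Carrier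
  indicator P? x = if does (P? x) then 1# else 0#

  0≤indicator : {P : Pred A q} (P? : Decidable P) → ∀ x → 0# ≤ indicator P? x
  0≤indicator P? x with does (P? x)
  ... | true  = 0≤1
  ... | false = ≤-refl

  indicator-mono : ∀ {p} {P : Pred A p} {Q : Pred B q} (P? : Decidable P) (Q? : Decidable Q) {x y} →
                   (P x → Q y) → indicator P? x ≤ indicator Q? y
  indicator-mono P? Q? {x} {y} P⇒Q with P? x | Q? y
  ... | yes Px | yes _  = ≤-refl
  ... | yes Px | no ¬Qy = ⊥-elim (¬Qy (P⇒Q Px))
  ... | no  _  | yes _  = 0≤1
  ... | no  _  | no  _  = ≤-refl

  -- Replaces filtered sums by expectations, which are linear and unfold along `>>=`.
  Pr≈𝔼 : ∀ {P : Pred A q} (d : Dist A) (P? : Decidable P) → Pr d P? ≈ 𝔼 d (indicator P?)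
  Pr≈𝔼 []            P? = refl
  Pr≈𝔼 ((w , x) ∷ d) P? with does (P? x)
  ... | true  = +-cong (sym (*-identityʳ w)) (Pr≈𝔼 d P?)
  ... | false = trans (Pr≈𝔼 d P?) (sym (trans (+-congʳ (zeroʳ w)) (+-identityˡ _)))

  total≈𝔼1 : ∀ (d : Dist A) → total (map proj₁ d) ≈ 𝔼 d (const 1#)
  total≈𝔼1 []            = refl
  total≈𝔼1 ((w , x) ∷ d) = +-cong (sym (*-identityʳ w)) (total≈𝔼1 d)

  Pr+Pr-∁≈1 : ∀ {P : Pred A q} {d : Dist A} → IsProbability d → (P? : Decidable P) →
              Pr d P? + Pr d (¬? ∘ P?) ≈ 1#
  Pr+Pr-∁≈1 {d = d} (_ , total≈1) P? = begin
    Pr d P? + Pr d (¬? ∘ P?)                            ≈⟨ +-cong (Pr≈𝔼 d P?) (Pr≈𝔼 d (¬? ∘ P?)) ⟩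
    𝔼 d (indicator P?) + 𝔼 d (indicator (¬? ∘ P?))      ≈⟨ 𝔼-+ d _ _ ⟨
    𝔼 d (λ x → indicator P? x + indicator (¬? ∘ P?) x)  ≈⟨ 𝔼-cong d sum≈1 ⟩
    𝔼 d (const 1#)                                      ≈⟨ total≈𝔼1 d ⟨
    total (map proj₁ d)                                 ≈⟨ total≈1 ⟩
    1#                                                  ∎
    where
    open SetoidReasoning R.setoid
    sum≈1 : ∀ x → indicator P? x + indicator (¬? ∘ P?) x ≈ 1#
    sum≈1 x with does (P? x)
    ... | true  = +-identityʳ 1#
    ... | false = +-identityˡ 1#

  return-isProbability : ∀ (x : A) → IsProbability (return x)
  return-isProbability x = 0≤1 ∷ [] , +-identityʳ 1#

  >>=-isProbability : ∀ {d : Dist A} {k : A → Dist B} →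
                      IsProbability d → (∀ x → IsProbability (k x)) → IsProbability (d >>= k)
  >>=-isProbability {d = d} {k} (0≤d , total≈1) k-prob = nonNegative d 0≤d , (begin
    total (map proj₁ (d >>= k))        ≈⟨ total≈𝔼1 (d >>= k) ⟩
    𝔼 (d >>= k) (const 1#)             ≈⟨ 𝔼->>= d k _ ⟩
    𝔼 d (λ x → 𝔼 (k x) (const 1#))     ≈⟨ 𝔼-cong d (λ x → trans (sym (total≈𝔼1 (k x))) (proj₂ (k-prob x))) ⟩
    𝔼 d (const 1#)                     ≈⟨ total≈𝔼1 d ⟨
    total (map proj₁ d)                ≈⟨ total≈1 ⟩
    1#                                 ∎)
    where
    open SetoidReasoning R.setoid
    scale : ∀ {w} → 0# ≤ w → (d : Dist B) → NonNegative d → NonNegative (map (map₁ (w *_)) d)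
    scale 0≤w []      []           = []
    scale 0≤w (_ ∷ d) (0≤v ∷ 0≤d) = *-nonNegative 0≤w 0≤v ∷ scale 0≤w d 0≤d
    append : (d d′ : Dist B) → NonNegative d → NonNegative d′ → NonNegative (d ++ d′)
    append []      d′ []           0≤d′ = 0≤d′
    append (_ ∷ d) d′ (0≤v ∷ 0≤d) 0≤d′ = 0≤v ∷ append d d′ 0≤d 0≤d′
    nonNegative : ∀ d → NonNegative d → NonNegative (d >>= k)
    nonNegative []            []           = []
    nonNegative ((w , x) ∷ d) (0≤w ∷ 0≤d) = append (map (map₁ (w *_)) (k x)) (d >>= k)
      (scale 0≤w (k x) (proj₁ (k-prob x))) (nonNegative d 0≤d)

  uniform-isProbability : ∀ (xs : List A) .{{_ : NonZero (length xs)}} → IsProbability (uniform xs)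
  uniform-isProbability xs = nonNegative xs , trans (sum≈ xs) (n×1*1/n≈1 (length xs))
    where
    u = 1/ length xs
    nonNegative : ∀ ys → NonNegative (map (u ,_) ys)
    nonNegative []       = []
    nonNegative (_ ∷ ys) = 0≤1/n (length xs) ∷ nonNegative ys
    sum≈ : ∀ ys → total (map proj₁ (map (u ,_) ys)) ≈ length ys ×1 * u
    sum≈ []       = sym (zeroˡ u)
    sum≈ (_ ∷ ys) = trans (+-cong (sym (*-identityˡ u)) (sum≈ ys)) (sym (distribʳ u 1# _))

  replicate-isProbability : ∀ m {d : Dist A} → IsProbability d → IsProbability (replicate m d)
  replicate-isProbability {A = A} zero    d-prob = return-isProbability {A = Vec A zero} []
  replicate-isProbability (suc m) d-prob = >>=-isProbability d-prob λ x →
    >>=-isProbability (replicate-isProbability m d-prob) λ xs → return-isProbability (x ∷ xs)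

  run-isProbability : ∀ (alg : Algorithm n) less → IsProbability (run alg less)
  run-isProbability (output σ)        less = return-isProbability σ
  run-isProbability (compare i j k)   less = run-isProbability (k (less i j)) less
  run-isProbability (draw d d-prob k) less = >>=-isProbability d-prob λ x → run-isProbability (k x) less

  -- The algorithm consults `less` at `compare` nodes only. Since the weighted lists themselves are
  -- equal, one can be substituted for the other inside an expectation.
  run-cong : ∀ (alg : Algorithm n) {less less′} → (∀ i j → less i j ≡ less′ i j) →
             run alg less ≡ run alg less′
  run-cong (output σ)      eq = ≡.refl
  run-cong (compare i j k) {less} eq rewrite ≡.sym (eq i j) = run-cong (k (less i j)) eq
  run-cong (draw d _ k)    eq =
    concatMap-cong (λ (w , x) → cong (map (map₁ (w *_))) (run-cong (k x) eq)) d

  -- Relabelling of uniform permutations and exchangeability of independent draws.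

  module _ {s ℓ} (S : Setoid s ℓ) where
    open Setoid S using () renaming (Carrier to X; _≈_ to _≋_; sym to ≋-sym; trans to ≋-trans)
    open SetoidMembership S using (_∈_)
    open SetoidUnique S using (Unique)

    private
      𝔼-─ : ∀ {g : X → Carrier} → (∀ {x y} → x ≋ y → g x ≈ g y) → ∀ {x ys} (x∈ys : x ∈ ys) →
            𝔼 (map (w ,_) ys) g ≈ w * g x + 𝔼 (map (w ,_) (ys ─ x∈ys)) g
      𝔼-─ g-cong (here x≋y)           = +-congʳ (*-congˡ (sym (g-cong x≋y)))
      𝔼-─ g-cong {ys = y ∷ _} (there x∈ys) = trans (+-congˡ (𝔼-─ g-cong x∈ys)) (x+[y+z]≈y+[x+z] _ _ _)
        where open CommutativeSemigroupProperties R.+-commutativeSemigroup using () renaming (x∙yz≈y∙xz to x+[y+z]≈y+[x+z])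

      ∈-─ : ∀ {x y ys} (x∈ys : x ∈ ys) → ¬ x ≋ y → y ∈ ys → y ∈ (ys ─ x∈ys)
      ∈-─ (here x≋z)   x≉y (here y≋z)   = ⊥-elim (x≉y (≋-trans x≋z (≋-sym y≋z)))
      ∈-─ (here x≋z)   x≉y (there y∈ys) = y∈ys
      ∈-─ (there x∈ys) x≉y (here y≋z)   = here y≋z
      ∈-─ (there x∈ys) x≉y (there y∈ys) = there (∈-─ x∈ys x≉y y∈ys)

    -- Each entry of `xs` is matched with an equivalent entry of `ys`, which is then deleted.
    -- Uniqueness of `xs` keeps the matches of the later entries in the list, and whatever is left
    -- of `ys` contributes a nonnegative amount.
    𝔼-⊆ : ∀ {g : X → Carrier} → (∀ {x y} → x ≋ y → g x ≈ g y) → (∀ x → 0# ≤ g x) → 0# ≤ w →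
          ∀ {xs ys} → Unique xs → All (_∈ ys) xs → 𝔼 (map (w ,_) xs) g ≤ 𝔼 (map (w ,_) ys) g
    𝔼-⊆ {w} {g} g-cong 0≤g 0≤w {[]} {ys} [] [] = 𝔼-nonNegative {d = map (w ,_) ys} {g}
      (Allₚ.map⁺ (Allₚ.map⁺ (All.universal (λ _ → 0≤w) ys))) 0≤g
    𝔼-⊆ {w} {g} g-cong 0≤g 0≤w {x ∷ xs} {ys} (x∉xs ∷ xs!) (x∈ys ∷ xs⊆ys) = ≤-trans
      (+-mono-≤ ≤-refl (𝔼-⊆ g-cong 0≤g 0≤w xs!
        (All.zipWith (λ (x≉y , y∈ys) → ∈-─ x∈ys x≉y y∈ys) (x∉xs , xs⊆ys))))
      (≤-reflexive (sym (𝔼-─ g-cong x∈ys)))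

  -- Composition with `ρ` is injective, so the relabelled list has no repetitions, and the full list
  -- contains all its members up to pointwise equality. This is one half of the invariance of the
  -- uniform distribution.
  𝔼-randomPermutation-∘ₚ : ∀ {g : Permutation′ n → Carrier} → (∀ {π ρ} → π Perm.≈ ρ → g π ≈ g ρ) →
    (∀ π → 0# ≤ g π) → ∀ ρ → 𝔼 (randomPermutation n) (λ π → g (π ∘ₚ ρ)) ≤ 𝔼 (randomPermutation n) g
  𝔼-randomPermutation-∘ₚ {n} {g} g-cong 0≤g ρ = ≤-trans (≤-reflexive (𝔼-relabel (permutations n)))
    (𝔼-⊆ (permutationSetoid n) g-cong 0≤g (0≤1/n _ {{permutations-nonEmpty n}})
      (SetoidUniqueₚ.map⁺ (permutationSetoid n) (permutationSetoid n)
        (λ e i → ρ-injective (e i)) (permutations-unique n))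
      (All.universal (permutations-complete n) _))
    where
    ρ-injective : ∀ {i j} → ρ ⟨$⟩ʳ i ≡ ρ ⟨$⟩ʳ j → i ≡ j
    ρ-injective e = ≡.trans (≡.sym (inverseˡ ρ)) (≡.trans (cong (ρ ⟨$⟩ˡ_) e) (inverseˡ ρ))
    𝔼-relabel : ∀ πs → 𝔼 (map (w ,_) πs) (λ π → g (π ∘ₚ ρ)) ≈ 𝔼 (map (w ,_) (map (_∘ₚ ρ) πs)) g
    𝔼-relabel []       = refl
    𝔼-relabel (π ∷ πs) = +-congˡ (𝔼-relabel πs)

  -- Exchangeability: the entry at position `i` may be drawn before all others. It accounts for the
  -- bit that `cycleErrors` moves into the middle of a row.
  𝔼-replicate-insertAt : ∀ m (d : Dist A) i (g : Vec A (suc m) → Carrier) →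
    𝔼 (replicate (suc m) d) g ≈ 𝔼 d (λ x → 𝔼 (replicate m d) (λ xs → g (insertAt xs i x)))
  𝔼-replicate-insertAt m       d zero    g = 𝔼-map₂ d (const (replicate m d)) _∷_ g
  𝔼-replicate-insertAt (suc m) d (suc i) g = begin
    𝔼 (replicate (2 ℕ.+ m) d) g
      ≈⟨ 𝔼-map₂ d (const (replicate (suc m) d)) _∷_ g ⟩
    𝔼 d (λ y → 𝔼 (replicate (suc m) d) (λ xs → g (y ∷ xs)))
      ≈⟨ 𝔼-cong d (λ y → 𝔼-replicate-insertAt m d i (λ xs → g (y ∷ xs))) ⟩
    𝔼 d (λ y → 𝔼 d (λ x → 𝔼 (replicate m d) (λ xs → g (y ∷ insertAt xs i x))))
      ≈⟨ 𝔼-swap d d _ ⟩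
    𝔼 d (λ x → 𝔼 d (λ y → 𝔼 (replicate m d) (λ xs → g (y ∷ insertAt xs i x))))
      ≈⟨ 𝔼-cong d (λ x → 𝔼-map₂ d (const (replicate m d)) _∷_ (λ xs → g (insertAt xs (suc i) x))) ⟨
    𝔼 d (λ x → 𝔼 (replicate (suc m) d) (λ xs → g (insertAt xs (suc i) x)))  ∎
    where open SetoidReasoning R.setoid

-- The probability cost of a cyclic shift.

module LowerBound {c ℓ₁ ℓ₂ ℓ₃} (F : ArchimedeanOrderedField c ℓ₁ ℓ₂ ℓ₃) where
  open ArchimedeanOrderedField F
  open Sorting F
  open OrderedFieldProperties F
  open Expectation F

  private module R = CommutativeRing commutativeRing
  open CommutativeSemigroupProperties R.*-commutativeSemigroup using () renaming (x∙yz≈y∙xz to x*yz≈y*xz)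
  open RingProperties R.ring using (-‿distribʳ-*)

  module _ {p : Carrier} (0≤p : 0# ≤ p) (p≤1-p : p ≤ 1# - p) where
    open ≤-Reasoning

    private
      0≤1-p : 0# ≤ 1# - p
      0≤1-p = ≤-trans 0≤p p≤1-p

      1-p≤1 : 1# - p ≤ 1#
      1-p≤1 = +-cancelʳ-≤ p (begin
        (1# - p) + p  ≈⟨ x-z+z≈x 1# p ⟩
        1#            ≈⟨ +-identityʳ 1# ⟨
        1# + 0#       ≲⟨ +-mono-≤ ≤-refl 0≤p ⟩
        1# + p        ∎)

    bernoulli-isProbability : IsProbability (bernoulli p)
    bernoulli-isProbability = 0≤p ∷ 0≤1-p ∷ [] ,
      trans (+-congˡ (+-identityʳ _)) (trans (+-comm p _) (x-z+z≈x 1# p))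

    randomErrors-isProbability : ∀ n → IsProbability (randomErrors p n)
    randomErrors-isProbability zero    = return-isProbability tt
    randomErrors-isProbability (suc n) =
      >>=-isProbability (replicate-isProbability n bernoulli-isProbability) λ bs →
      >>=-isProbability (randomErrors-isProbability n) λ e → return-isProbability (bs , e)

    randomPermutation-isProbability : ∀ n → IsProbability (randomPermutation n)
    randomPermutation-isProbability n =
      uniform-isProbability (permutations n) {{permutations-nonEmpty n}}

    randomOutput-isProbability : ∀ (alg : Algorithm n) → IsProbability (randomOutput p alg)
    randomOutput-isProbability {n} alg =
      >>=-isProbability
        (>>=-isProbability (randomPermutation-isProbability n) λ π →
          >>=-isProbability (randomErrors-isProbability n) λ e → return-isProbability (π , e))
        λ (π , e) → >>=-isProbability (run-isProbability alg _) λ σ → return-isProbability (σ ∘ₚ π)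

    -- Negation exchanges the weights `p` and `1# - p`. The coefficient of `g false` is bounded by
    -- `p * p ≤ p ≤ 1# - p`, that of `g true` by `p * (1# - p) ≤ p`.
    𝔼-bernoulli-not : ∀ {g} → (∀ b → 0# ≤ g b) → p * 𝔼 (bernoulli p) (g ∘ not) ≤ 𝔼 (bernoulli p) g
    𝔼-bernoulli-not {g} 0≤g = begin
      p * (p * g false + ((1# - p) * g true + 0#))
        ≈⟨ *-congˡ (+-congˡ (+-identityʳ _)) ⟩
      p * (p * g false + (1# - p) * g true)
        ≈⟨ distribˡ p _ _ ⟩
      p * (p * g false) + p * ((1# - p) * g true)
        ≲⟨ +-mono-≤ (≤-trans (*-monoʳ-≤ 0≤p (shrink (≤-trans p≤1-p 1-p≤1) (0≤g false)))
                              (*-monoˡ-≤ (0≤g false) p≤1-p))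
                    (*-monoʳ-≤ 0≤p (shrink 1-p≤1 (0≤g true))) ⟩
      (1# - p) * g false + p * g true
        ≈⟨ +-comm _ _ ⟩
      p * g true + (1# - p) * g false
        ≈⟨ +-congˡ (+-identityʳ _) ⟨
      p * g true + ((1# - p) * g false + 0#)  ∎
      where
      shrink : ∀ {x y} → x ≤ 1# → 0# ≤ y → x * y ≤ y
      shrink x≤1 0≤y = ≤-trans (*-monoˡ-≤ 0≤y x≤1) (≤-reflexive (*-identityˡ _))

    𝔼-randomErrors-suc : ∀ n g → 𝔼 (randomErrors p (suc n)) g ≈
      𝔼 (replicate n (bernoulli p)) (λ bs → 𝔼 (randomErrors p n) (λ e → g (bs , e)))
    𝔼-randomErrors-suc n g = 𝔼-map₂ (replicate n (bernoulli p)) (const (randomErrors p n)) _,_ g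

    -- Each step of `cycleErrors` flips one bit, and p · Pr[b] ≤ Pr[not b] for a single bit b.
    𝔼-cycleErrors : ∀ (d : Fin (suc n)) {g} → (∀ e → 0# ≤ g e) →
      p ^ toℕ d * 𝔼 (randomErrors p (suc n)) (g ∘ cycleErrors d) ≤ 𝔼 (randomErrors p (suc n)) g
    𝔼-cycleErrors zero 0≤g = ≤-reflexive (*-identityˡ _)
    𝔼-cycleErrors {suc n} (suc d) {g} 0≤g = begin
      p ^ suc (toℕ d) * 𝔼 (randomErrors p (2 ℕ.+ n)) (g ∘ cycleErrors (suc d))
        ≈⟨ *-congˡ unfold ⟩
      p ^ suc (toℕ d) * 𝔼 B (λ b → 𝔼 Bⁿ (shifted (not b)))
        ≈⟨ *-assoc p P _ ⟩
      p * (P * 𝔼 B (λ b → 𝔼 Bⁿ (shifted (not b))))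
        ≈⟨ *-congˡ (𝔼-*ˡ B P (λ b → 𝔼 Bⁿ (shifted (not b)))) ⟨
      p * 𝔼 B (λ b → P * 𝔼 Bⁿ (shifted (not b)))
        ≲⟨ *-monoʳ-≤ 0≤p (𝔼-mono {d = B} {λ b → P * 𝔼 Bⁿ (shifted (not b))} {λ b → plain (not b)}
             (proj₁ bernoulli-isProbability) λ b → shifted≤plain (not b)) ⟩
      p * 𝔼 B (plain ∘ not)
        ≲⟨ 𝔼-bernoulli-not (λ b → 𝔼-nonNegative 0≤Bⁿ λ cs →
             𝔼-nonNegative (proj₁ (randomErrors-isProbability (suc n))) λ e → 0≤g (insertAt cs d b , e)) ⟩
      𝔼 B plain
        ≈⟨ 𝔼-replicate-insertAt n B d (λ cs → 𝔼 Eₙ (λ e → g (cs , e))) ⟨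
      𝔼 (replicate (suc n) B) (λ cs → 𝔼 Eₙ (λ e → g (cs , e)))
        ≈⟨ 𝔼-randomErrors-suc (suc n) g ⟨
      𝔼 (randomErrors p (2 ℕ.+ n)) g  ∎
      where
      P  = p ^ toℕ d
      B  = bernoulli p
      Bⁿ = replicate n B
      Eₙ = randomErrors p (suc n)
      0≤Bⁿ = proj₁ (replicate-isProbability n bernoulli-isProbability)

      -- Both functions fix the bit `b` at index `d` of the first row. In `shifted` the remaining
      -- rows still pass through `cycleErrors d`, and the induction hypothesis removes it at cost
      -- `P`.
      shifted : Bool → Vec Bool n → Carrier
      shifted b cs = 𝔼 Eₙ (λ e → g (insertAt cs d b , cycleErrors d e))

      plain : Bool → Carrier
      plain b = 𝔼 Bⁿ (λ cs → 𝔼 Eₙ (λ e → g (insertAt cs d b , e)))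

      shifted≤plain : ∀ b → P * 𝔼 Bⁿ (shifted b) ≤ plain b
      shifted≤plain b = ≤-trans (≤-reflexive (sym (𝔼-*ˡ Bⁿ P (shifted b))))
        (𝔼-mono 0≤Bⁿ λ cs → 𝔼-cycleErrors d λ e → 0≤g (insertAt cs d b , e))

      unfold : 𝔼 (randomErrors p (2 ℕ.+ n)) (g ∘ cycleErrors (suc d)) ≈
               𝔼 B (λ b → 𝔼 Bⁿ (shifted (not b)))
      unfold = begin-equality
        𝔼 (randomErrors p (2 ℕ.+ n)) (g ∘ cycleErrors (suc d))
          ≈⟨ 𝔼-randomErrors-suc (suc n) (g ∘ cycleErrors (suc d)) ⟩
        𝔼 (replicate (suc n) B) (λ bs → 𝔼 Eₙ (λ e → g (cycleErrors (suc d) (bs , e))))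
          ≈⟨ 𝔼-map₂ B (const Bⁿ) _∷_ (λ bs → 𝔼 Eₙ (λ e → g (cycleErrors (suc d) (bs , e)))) ⟩
        𝔼 B (λ b → 𝔼 Bⁿ (λ bs → 𝔼 Eₙ (λ e → g (cycleErrors (suc d) (b ∷ bs , e)))))
          ≈⟨ 𝔼-cong B swapTails ⟩
        𝔼 B (λ b → 𝔼 Bⁿ (shifted (not b)))  ∎
        where
        -- The tail `bs` of the first row and the second row `cs` have the same length and
        -- distribution. Exchanging the order of their draws makes `(bs , e)`, the argument of the
        -- recursive call, a sample of `Eₙ`.
        swapTails : ∀ b → 𝔼 Bⁿ (λ bs → 𝔼 Eₙ (λ e → g (cycleErrors (suc d) (b ∷ bs , e)))) ≈
                          𝔼 Bⁿ (shifted (not b))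
        swapTails b = begin-equality
          𝔼 Bⁿ (λ bs → 𝔼 Eₙ (λ e → g (cycleErrors (suc d) (b ∷ bs , e))))
            ≈⟨ 𝔼-cong Bⁿ (λ bs → 𝔼-randomErrors-suc n (λ e → g (cycleErrors (suc d) (b ∷ bs , e)))) ⟩
          𝔼 Bⁿ (λ bs → 𝔼 Bⁿ (λ cs → 𝔼 (randomErrors p n) (λ e → g (insertAt cs d (not b) , cycleErrors d (bs , e)))))
            ≈⟨ 𝔼-swap Bⁿ Bⁿ _ ⟩
          𝔼 Bⁿ (λ cs → 𝔼 Bⁿ (λ bs → 𝔼 (randomErrors p n) (λ e → g (insertAt cs d (not b) , cycleErrors d (bs , e)))))
            ≈⟨ 𝔼-cong Bⁿ (λ cs → 𝔼-randomErrors-suc n (λ e → g (insertAt cs d (not b) , cycleErrors d e))) ⟨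
          𝔼 Bⁿ (shifted (not b))  ∎

    -- Good outputs against bad outputs.

    𝔼-randomOutput : ∀ (alg : Algorithm n) g → 𝔼 (randomOutput p alg) g ≈
      𝔼 (randomPermutation n) (λ π → 𝔼 (randomErrors p n) (λ e →
        𝔼 (run alg (λ i j → reportsLess e (π ⟨$⟩ʳ i) (π ⟨$⟩ʳ j))) (λ σ → g (σ ∘ₚ π))))
    𝔼-randomOutput {n} alg g = trans
      (𝔼-map₂ (randomInstance p n)
        (λ (π , e) → run alg (λ i j → reportsLess e (π ⟨$⟩ʳ i) (π ⟨$⟩ʳ j))) (λ (π , _) σ → σ ∘ₚ π) g)
      (𝔼-map₂ (randomPermutation n) (const (randomErrors p n)) _,_ _)

    -- For each fixed instance, success is at most as likely as failure on the shifted instance.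
    -- Undoing the shift of the errors uses up the factor `p ^ toℕ d`, and undoing the shift of the
    -- uniform permutation is free.
    Pr-good≤Pr-bad : ∀ (alg : Algorithm (suc n)) {m} (d : Fin (suc n)) → m +ℕ m <ℕ toℕ d →
      p ^ toℕ d * Pr (randomOutput p alg) (λ s → maxDislocation s ≤? m) ≤
      Pr (randomOutput p alg) (λ s → ¬? (maxDislocation s ≤? m))
    Pr-good≤Pr-bad {n} alg {m} d 2m<d = begin
      p ^ toℕ d * Pr (randomOutput p alg) good?
        ≈⟨ *-congˡ (trans (Pr≈𝔼 (randomOutput p alg) good?) (𝔼-randomOutput alg (indicator good?))) ⟩
      p ^ toℕ d * 𝔼 Π (λ π → 𝔼 E (good π))
        ≈⟨ 𝔼-*ˡ Π _ _ ⟨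
      𝔼 Π (λ π → p ^ toℕ d * 𝔼 E (good π))
        ≲⟨ 𝔼-mono 0≤Π (λ π → *-monoʳ-≤ (^-nonNegative 0≤p (toℕ d)) (𝔼-mono 0≤E (good≤bad π))) ⟩
      𝔼 Π (λ π → p ^ toℕ d * 𝔼 E (λ e → bad (π ∘ₚ cycle d) (cycleErrors d e)))
        ≲⟨ 𝔼-mono 0≤Π (λ π → 𝔼-cycleErrors d (0≤bad (π ∘ₚ cycle d))) ⟩
      𝔼 Π (λ π → 𝔼 E (bad (π ∘ₚ cycle d)))
        ≲⟨ 𝔼-randomPermutation-∘ₚ (λ {π} {ρ} π≈ρ → 𝔼-cong E (bad-cong π ρ π≈ρ))
             (λ π → 𝔼-nonNegative 0≤E (0≤bad π)) (cycle d) ⟩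
      𝔼 Π (λ π → 𝔼 E (bad π))
        ≈⟨ trans (Pr≈𝔼 (randomOutput p alg) bad?) (𝔼-randomOutput alg (indicator bad?)) ⟨
      Pr (randomOutput p alg) bad?  ∎
      where
      Π = randomPermutation (suc n)
      E = randomErrors p (suc n)
      0≤Π = proj₁ (randomPermutation-isProbability (suc n))
      0≤E = proj₁ (randomErrors-isProbability (suc n))

      good? = λ (s : Permutation′ (suc n)) → maxDislocation s ≤? m
      bad?  = λ (s : Permutation′ (suc n)) → ¬? (maxDislocation s ≤? m)

      reports : Permutation′ (suc n) → Errors (suc n) → Fin (suc n) → Fin (suc n) → Bool
      reports π e i j = reportsLess e (π ⟨$⟩ʳ i) (π ⟨$⟩ʳ j)

      good bad : Permutation′ (suc n) → Errors (suc n) → Carrier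
      good π e = 𝔼 (run alg (reports π e)) (λ σ → indicator good? (σ ∘ₚ π))
      bad  π e = 𝔼 (run alg (reports π e)) (λ σ → indicator bad? (σ ∘ₚ π))

      0≤bad : ∀ π e → 0# ≤ bad π e
      0≤bad π e = 𝔼-nonNegative (proj₁ (run-isProbability alg _)) λ σ → 0≤indicator bad? (σ ∘ₚ π)

      -- The list of permutations is complete only up to pointwise equality, so `bad` has to respect
      -- it.
      bad-cong : ∀ π ρ → π Perm.≈ ρ → ∀ e → bad π e ≈ bad ρ e
      bad-cong π ρ π≈ρ e = trans
        (reflexive (cong (λ D → 𝔼 D (λ σ → indicator bad? (σ ∘ₚ π)))
          (run-cong alg λ i j → cong₂ (reportsLess e) (π≈ρ i) (π≈ρ j))))
        (𝔼-cong (run alg (reports ρ e)) λ σ → reflexive (cong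
          (λ k → if not (does (k ≤? m)) then 1# else 0#)
          (maxDislocation-cong {s = σ ∘ₚ π} {σ ∘ₚ ρ} (λ i → π≈ρ (σ ⟨$⟩ʳ i)))))

      -- The two instances give the same reports, hence the same distribution of `σ`; any `σ` that
      -- is good for the first is bad for the second by `cycle-dislocates`.
      good≤bad : ∀ π e → good π e ≤ bad (π ∘ₚ cycle d) (cycleErrors d e)
      good≤bad π e = ≤-trans
        (𝔼-mono (proj₁ (run-isProbability alg (reports π e))) λ σ →
          indicator-mono good? bad? {σ ∘ₚ π} {σ ∘ₚ (π ∘ₚ cycle d)} λ s≤m →
            ≡.subst (λ k → ¬ k ≤ℕ m)
              (maxDislocation-cong {s = (σ ∘ₚ π) ∘ₚ cycle d} {σ ∘ₚ (π ∘ₚ cycle d)} λ _ → ≡.refl)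
              (cycle-dislocates d 2m<d (σ ∘ₚ π) s≤m))
        (reflexive′ (cong (λ D → 𝔼 D (λ σ → indicator bad? (σ ∘ₚ (π ∘ₚ cycle d))))
          (≡.sym (run-cong alg λ i j → reportsLess-cycle d e (π ⟨$⟩ʳ i) (π ⟨$⟩ʳ j)))))
        where
        reflexive′ : ∀ {x y} → x ≡ y → x ≤ y
        reflexive′ x≡y = ≤-reflexive (reflexive x≡y)

    -- Multiplication by the number `suc n` of elements turns the success bound `1# - 1/ suc n` into
    -- `n ×1` and the failure bound `1/ suc n` into `1#`.
    p^d*n≤1 : ∀ (alg : Algorithm (suc n)) {m} (d : Fin (suc n)) → m +ℕ m <ℕ toℕ d →
      1# - 1/ suc n ≤ Pr (randomOutput p alg) (λ s → maxDislocation s ≤? m) →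
      p ^ toℕ d * n ×1 ≤ 1#
    p^d*n≤1 {n} alg {m} d 2m<d 1-1/n≤X = begin
      P * n ×1                                ≈⟨ *-congˡ n≈[1+n]*[1-1/[1+n]] ⟩
      P * (suc n ×1 * (1# - 1/ suc n))        ≈⟨ x*yz≈y*xz P (suc n ×1) _ ⟩
      suc n ×1 * (P * (1# - 1/ suc n))        ≲⟨ *-monoʳ-≤ (0≤n×1 (suc n)) (*-monoʳ-≤ (^-nonNegative 0≤p (toℕ d)) 1-1/n≤X) ⟩
      suc n ×1 * (P * X)                      ≲⟨ *-monoʳ-≤ (0≤n×1 (suc n)) (≤-trans (Pr-good≤Pr-bad alg d 2m<d) Y≤1/n) ⟩
      suc n ×1 * 1/ suc n                     ≈⟨ n×1*1/n≈1 (suc n) ⟩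
      1#                                      ∎
      where
      P = p ^ toℕ d
      X = Pr (randomOutput p alg) (λ s → maxDislocation s ≤? m)
      Y = Pr (randomOutput p alg) (λ s → ¬? (maxDislocation s ≤? m))

      Y≤1/n : Y ≤ 1/ suc n
      Y≤1/n = +-cancelʳ-≤ X (begin
        Y + X                            ≈⟨ +-comm Y X ⟩
        X + Y                            ≈⟨ Pr+Pr-∁≈1 (randomOutput-isProbability alg) _ ⟩
        1#                               ≈⟨ x-z+z≈x 1# (1/ suc n) ⟨
        (1# - 1/ suc n) + 1/ suc n       ≲⟨ +-monoˡ-≤ (1/ suc n) 1-1/n≤X ⟩
        X + 1/ suc n                     ≈⟨ +-comm X _ ⟩
        1/ suc n + X                     ∎)

      n≈[1+n]*[1-1/[1+n]] : n ×1 ≈ suc n ×1 * (1# - 1/ suc n)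
      n≈[1+n]*[1-1/[1+n]] = begin-equality
        n ×1                                      ≈⟨ x+z-z≈x (n ×1) 1# ⟨
        (n ×1 + 1#) - 1#                          ≈⟨ +-cong (+-comm (n ×1) 1#) (-‿cong (sym (n×1*1/n≈1 (suc n)))) ⟩
        suc n ×1 - suc n ×1 * 1/ suc n            ≈⟨ +-cong (sym (*-identityʳ _)) (-‿distribʳ-* _ _) ⟩
        suc n ×1 * 1# + suc n ×1 * - 1/ suc n     ≈⟨ distribˡ _ 1# _ ⟨
        suc n ×1 * (1# - 1/ suc n)                ∎

-- Choice of the parameters and the contradiction.

n<2^n : ∀ n → n <ℕ 2 ^ℕ n
n<2^n zero    = s≤s z≤n
n<2^n (suc n) = begin-strict
  suc n                     ≤⟨ n<2^n n ⟩
  2 ^ℕ n                    <⟨ ℕₚ.m<m+n (2 ^ℕ n) (ℕₚ.m^n>0 2 n) ⟩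
  2 ^ℕ n +ℕ 2 ^ℕ n          ≡⟨ cong (2 ^ℕ n +ℕ_) (ℕₚ.+-identityʳ _) ⟨
  2 ^ℕ suc n                ∎
  where open ℕₚ.≤-Reasoning

private
  -- Doubling the successor of the left side gives `4km + (2k + 2)`, with both summands at most `l`.
  -- Hence the constant `4k` asked of the little-o bound and the summand `2k + 2` in `L`.
  k[1+2m]<l : ∀ k m l → (4 *ℕ k) *ℕ m ≤ℕ l → 2 *ℕ k +ℕ 2 ≤ℕ l → k *ℕ suc (m +ℕ m) <ℕ l
  k[1+2m]<l k m l 4km≤l 2k+2≤l = ℕₚ.*-cancelˡ-≤ 2 (begin
    2 *ℕ suc (k *ℕ suc (m +ℕ m))              ≡⟨ solve 2 (λ k m →
        con 2 :* (con 1 :+ k :* (con 1 :+ (m :+ m))) :=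
        (con 4 :* k) :* m :+ (con 2 :* k :+ con 2)) ≡.refl k m ⟩
    (4 *ℕ k) *ℕ m +ℕ (2 *ℕ k +ℕ 2)            ≤⟨ ℕₚ.+-mono-≤ 4km≤l 2k+2≤l ⟩
    l +ℕ l                                    ≡⟨ cong (l +ℕ_) (ℕₚ.+-identityʳ l) ⟨
    2 *ℕ l                                    ∎)
    where
    open ℕₚ.≤-Reasoning
    open +-*-Solver

theorem6p2 : ∀ {c ℓ₁ ℓ₂ ℓ₃} (F : ArchimedeanOrderedField c ℓ₁ ℓ₂ ℓ₃) →
    let open ArchimedeanOrderedField F
        open Sorting F
    in (p : Carrier) → 0# < p → p < 1/ 2 →
       ¬ (∃ λ (alg : ∀ n → Algorithm n) → ∃ λ (f : ℕ → ℕ) →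
            (f ∈o ⌊log₂_⌋) ×
            (∃ λ N → ∀ n .{{_ : NonZero n}} → N ≤ℕ n →
               1# - 1/ n ≤ Pr (randomOutput p (alg n)) (λ s → maxDislocation s ≤? f n)))
theorem6p2 F p 0<p p<½ (alg , f , f∈o , N , whp) with OrderedFieldProperties.archimedean-* F 0<p
-- Here `m` is the Archimedean multiplier and `f (suc n′)` the dislocation bound. As `≤` is a
-- negation, the inequality is applied directly to its refutation `1<p^D*n`.
... | m , 1<pm = p^d*n≤1 (<⇒≤ 0<p) (x<1/2⇒x≤1-x p<½) (alg (suc n′)) (fromℕ< D<1+n)
        (ℕₚ.≤-reflexive (≡.sym (toℕ-fromℕ< D<1+n)))
        (whp (suc n′) (≤L⇒≤1+n (ℕₚ.≤-trans (ℕₚ.m≤m+n N N′) (ℕₚ.m≤n+m _ (2 *ℕ k +ℕ 2)))))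
        (≡.subst (λ d → 1# < p ^ d * n′ ×1) (≡.sym (toℕ-fromℕ< D<1+n)) 1<p^D*n)
  where
  open ArchimedeanOrderedField F
  open OrderedFieldProperties F
  open LowerBound F
  k N′ L n′ D : ℕ
  -- Chosen so that `m ≤ 2 ^ k`, and nonzero so that `D ≤ k * D`.
  k  = suc m
  N′ = proj₁ (f∈o (4 *ℕ k))
  -- Large enough for the arithmetic and for both thresholds. Taking `2 ^ L` elements makes the
  -- logarithm exactly `L`.
  L  = (2 *ℕ k +ℕ 2) +ℕ (N +ℕ N′)
  n′ = ℕ.pred (2 ^ℕ L)
  D  = suc (f (suc n′) +ℕ f (suc n′))

  1+n≡2^L : suc n′ ≡ 2 ^ℕ L
  1+n≡2^L = ℕₚ.suc-pred (2 ^ℕ L) {{ℕₚ.m^n≢0 2 L}}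

  ≤L⇒≤1+n : ∀ {i} → i ≤ℕ L → i ≤ℕ suc n′
  ≤L⇒≤1+n {i} i≤L = ≡.subst (i ≤ℕ_) (≡.sym 1+n≡2^L) (ℕₚ.≤-trans i≤L (ℕₚ.<⇒≤ (n<2^n L)))

  4kf≤L : (4 *ℕ k) *ℕ f (suc n′) ≤ℕ L
  4kf≤L = ≡.subst ((4 *ℕ k) *ℕ f (suc n′) ≤ℕ_) (≡.trans (cong ⌊log₂_⌋ 1+n≡2^L) (⌊log₂[2^n]⌋≡n L))
    (proj₂ (f∈o (4 *ℕ k)) (suc n′) (≤L⇒≤1+n (ℕₚ.≤-trans (ℕₚ.m≤n+m N′ N) (ℕₚ.m≤n+m _ (2 *ℕ k +ℕ 2)))))

  kD<L : k *ℕ D <ℕ L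
  kD<L = k[1+2m]<l k (f (suc n′)) L 4kf≤L (ℕₚ.m≤m+n _ _)

  -- Guarantees that an element of rank `D` exists.
  D<1+n : D <ℕ suc n′
  D<1+n = ≤L⇒≤1+n (ℕₚ.≤-trans (s≤s (ℕₚ.m≤n*m D k)) kD<L)

  m^D≤n : m ^ℕ D ≤ℕ n′
  -- The strict inequality `k * D < L` absorbs the 1 by which `n′` falls short of `2 ^ L`.
  m^D≤n = ℕ.s≤s⁻¹ (begin-strict
    m ^ℕ D            ≤⟨ ℕₚ.^-monoˡ-≤ D (ℕₚ.≤-trans (ℕₚ.n≤1+n m) (ℕₚ.<⇒≤ (n<2^n k))) ⟩
    (2 ^ℕ k) ^ℕ D     ≡⟨ ℕₚ.^-*-assoc 2 k D ⟩
    2 ^ℕ (k *ℕ D)     <⟨ ℕₚ.^-monoʳ-< 2 ℕₚ.≤-refl kD<L ⟩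
    2 ^ℕ L            ≡⟨ 1+n≡2^L ⟨
    suc n′             ∎)
    where open ℕₚ.≤-Reasoning

  1<p^D*n : 1# < p ^ D * n′ ×1
  -- `p ^ D * n′` is at least `(p * m) ^ D`, which exceeds 1 strictly because `D` is a successor.
  1<p^D*n = <-≤-trans (<-respʳ-≈ (sym (x^d*m^d≈[x*m]^d p m D)) (1<x⇒1<x^[1+n] 1<pm (f (suc n′) +ℕ f (suc n′))))
    (*-monoʳ-≤ (^-nonNegative (<⇒≤ 0<p) D) (×1-mono-≤ m^D≤n))
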